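{- Let $d$ and $\Delta$ be integers with $1\le d\le\Delta$. The maximum possible value of $q_B(G)$ among all finite simple $d$-degenerate graphs $G$ with maximum degree $\Delta(G)\le\Delta$ is $d\Delta$. Moreover, for every such graph $G$, the following are equivalent: (i) $q_B(G)=d\Delta$; (ii) $G$ contains a copy of $K_{d,\Delta}$; (iii) $G$ has at least $d$ vertices of degree $\Delta$ with the same open neighborhood.
   Context: A $B$-coloring of a graph $G$ is a proper edge-coloring (incident edges receive distinct colors) in which the edges of every $4$-cycle receive four distinct colors; $q_B(G)$ is the minimum number of colors in a $B$-coloring of $G$. A graph is $d$-degenerate if every nonempty subgraph has a vertex of degree at most $d$ (in that subgraph). "Contains a copy of $K_{a,b}$" means contains a subgraph, not necessarily induced, isomorphic to the complete bipartite graph $K_{a,b}$. $\Delta(G)$ denotes the maximum degree of $G$. -}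

module Defs where

open import Data.Empty using (⊥; ⊥-elim)
open import Data.Fin using (Fin; zero; suc; combine; splitAt)
open import Data.Fin.Properties using (_≟_; any?; all?; combine-injective; ≤-total; ≤-antisym)
open import Data.Fin.Subset using (Subset; _∈_; Nonempty; ∣_∣)
open import Data.List using ([]; _∷_; map; allFin)
open import Data.List.Extrema.Nat using (max)
open import Data.List.Relation.Unary.All using ([]; _∷_)
open import Data.List.Relation.Unary.AllPairs using ([]; _∷_)
open import Data.List.Relation.Unary.Unique.Propositional using (Unique)
open import Data.List.Relation.Unary.Unique.DecPropositional using (unique?)
open import Data.Nat using (ℕ; zero; suc; _+_; _*_; _≤_; z≤n; s≤s)
open import Data.Product using (Σ; ∃; _×_; _,_; proj₁; proj₂; swap)
open import Data.Sum using (_⊎_; inj₁; inj₂; [_,_]′)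
open import Data.Unit using (⊤; tt)
open import Data.Vec using (Vec; []; _∷_; tabulate; lookup)
open import Data.Vec.Properties using (lookup∘tabulate)
open import Function using (_∘_)
open import Function.Bundles using (_↔_; _⇔_; Inverse)
open import Level using (0ℓ)
open import Relation.Binary using (Rel; Symmetric; Irreflexive; Decidable)
open import Relation.Binary.PropositionalEquality
  using (_≡_; _≢_; refl; sym; trans; cong; module ≡-Reasoning)
open import Relation.Nullary using (¬_; Dec; yes; no; does)
open import Relation.Nullary.Decidable using (map′; _×-dec_; _→-dec_; ¬?)
import Relation.Unary as U

-- Decidable adjacency encodes that the edges form a finite set; it is what
-- lets neighbourhoods be finite subsets with a cardinality.
record Graph (n : ℕ) : Set₁ where
  field
    Adj    : Rel (Fin n) 0ℓ
    adj?   : Decidable Adj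
    symm   : Symmetric Adj
    irrefl : Irreflexive _≡_ Adj

open Graph

N : ∀ {n} → Graph n → Fin n → Subset n
N G v = tabulate λ w → does (adj? G v w)

degree : ∀ {n} → Graph n → Fin n → ℕ
degree G v = ∣ N G v ∣

-- The graph on no vertices gets maximum degree 0.
maxDegree : ∀ {n} → Graph n → ℕ
maxDegree {n} G = max 0 (map (degree G) (allFin n))

-- A subgraph keeps the vertex names of G.  Its edges are recorded as a graph
-- on all of Fin n, in which the vertices outside `vertices` are isolated and
-- do not count as vertices of the subgraph.
record Subgraph {n : ℕ} (G : Graph n) : Set₁ where
  field
    vertices  : Subset n
    edges     : Graph n
    endpoints : ∀ {u v} → Adj edges u v → u ∈ vertices × v ∈ vertices
    included  : ∀ {u v} → Adj edges u v → Adj G u v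

open Subgraph

Degenerate : ∀ {n} → ℕ → Graph n → Set₁
Degenerate d G = (H : Subgraph G) → Nonempty (vertices H) →
  ∃ λ v → v ∈ vertices H × degree (edges H) v ≤ d

record _≅_ {m n : ℕ} {G : Graph n} (K : Graph m) (H : Subgraph G) : Set where
  field
    bijection : Fin m ↔ ∃ (_∈ vertices H)
  open Inverse bijection using (to)
  field
    adjacency : ∀ i j →
      Adj K i j ⇔ Adj (edges H) (proj₁ (to i)) (proj₁ (to j))

Contains : ∀ {m n} → Graph n → Graph m → Set₁
Contains G K = Σ (Subgraph G) λ H → K ≅ H

-- K a b is the complete bipartite graph; splitAt a tells the two parts apart.
module CompleteBipartite (a b : ℕ) where

  Across : Rel (Fin a ⊎ Fin b) 0ℓ
  Across (inj₁ _) (inj₁ _) = ⊥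
  Across (inj₁ _) (inj₂ _) = ⊤
  Across (inj₂ _) (inj₁ _) = ⊤
  Across (inj₂ _) (inj₂ _) = ⊥

  across? : Decidable Across
  across? (inj₁ _) (inj₁ _) = no λ ()
  across? (inj₁ _) (inj₂ _) = yes tt
  across? (inj₂ _) (inj₁ _) = yes tt
  across? (inj₂ _) (inj₂ _) = no λ ()

  across-sym : Symmetric Across
  across-sym {inj₁ _} {inj₂ _} _ = tt
  across-sym {inj₂ _} {inj₁ _} _ = tt

  across-irrefl : ∀ x → ¬ Across x x
  across-irrefl (inj₁ _) ()
  across-irrefl (inj₂ _) ()

K : ∀ a b → Graph (a + b)
K a b = record
  { Adj    = λ u v → Across (splitAt a u) (splitAt a v)
  ; adj?   = λ u v → across? (splitAt a u) (splitAt a v)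
  ; symm   = λ {u} {v} → across-sym {splitAt a u} {splitAt a v}
  ; irrefl = λ { {u} refl → across-irrefl (splitAt a u) }
  }
  where open CompleteBipartite a b

SameNeighbourhood : ∀ {n} → Graph n → ℕ → ℕ → Set
SameNeighbourhood {n} G d Δ = ∃ λ (S : Subset n) →
  d ≤ ∣ S ∣ ×
  (∀ {v} → v ∈ S → degree G v ≡ Δ) ×
  (∀ {u v} → u ∈ S → v ∈ S → N G u ≡ N G v)

-- A colour is attached to each proof of adjacency; `undirected` makes it
-- independent of the orientation of the edge and of the proof.
-- In `rainbow`, u v w x is a 4-cycle: its consecutive vertices are distinct
-- because they are adjacent.
record BColouring {n : ℕ} (G : Graph n) (k : ℕ) : Set where
  field
    colour     : ∀ {u v} → Adj G u v → Fin k
    undirected : ∀ {u v} (e : Adj G u v) (e′ : Adj G v u) →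
                 colour e ≡ colour e′
    proper     : ∀ {u v w} (e : Adj G u v) (f : Adj G u w) → v ≢ w →
                 colour e ≢ colour f
    rainbow    : ∀ {u v w x}
                 (e : Adj G u v) (f : Adj G v w) (g : Adj G w x) (h : Adj G x u) →
                 u ≢ w → v ≢ x →
                 Unique (colour e ∷ colour f ∷ colour g ∷ colour h ∷ [])

IsMinimum : (ℕ → Set) → ℕ → Set
IsMinimum P m = P m × (∀ k → P k → m ≤ k)

IsMaximum : (ℕ → Set₁) → ℕ → Set₁
IsMaximum P m = P m × (∀ k → P k → k ≤ m)

-- B-colourability is decidable, by a search through all matrices of colours.

Search : Set → Set₁
Search A = ∀ {P : A → Set} → U.Decidable P → Dec (∃ P)

search-Vec : ∀ {A} → Search A → ∀ n → Search (Vec A n)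
search-Vec s zero    P? = map′ (λ p → [] , p) (λ { ([] , p) → p }) (P? [])
search-Vec s (suc n) P? =
  map′ (λ { (a , v , p) → a ∷ v , p }) (λ { (a ∷ v , p) → a , v , p })
       (s λ a → search-Vec s n λ v → P? (a ∷ v))

Matrix : ℕ → ℕ → Set
Matrix n k = Vec (Vec (Fin k) n) n

_!_,_ : ∀ {n k} → Matrix n k → Fin n → Fin n → Fin k
M ! u , v = lookup (lookup M u) v

module _ {n : ℕ} (G : Graph n) where

  MatrixColouring : ∀ {k} → Matrix n k → Set
  MatrixColouring M =
    (∀ u v → Adj G u v → M ! u , v ≡ M ! v , u) ×
    (∀ u v w → Adj G u v → Adj G u w → v ≢ w → M ! u , v ≢ M ! u , w) ×
    (∀ u v w x → Adj G u v → Adj G v w → Adj G w x → Adj G x u →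
      u ≢ w → v ≢ x →
      Unique (M ! u , v ∷ M ! v , w ∷ M ! w , x ∷ M ! x , u ∷ []))

  matrixColouring? : ∀ {k} → U.Decidable (MatrixColouring {k})
  matrixColouring? M =
    (all? λ u → all? λ v → adj? G u v →-dec M ! u , v ≟ M ! v , u) ×-dec
    (all? λ u → all? λ v → all? λ w →
      adj? G u v →-dec adj? G u w →-dec
      ¬? (v ≟ w) →-dec ¬? (M ! u , v ≟ M ! u , w)) ×-dec
    (all? λ u → all? λ v → all? λ w → all? λ x →
      adj? G u v →-dec adj? G v w →-dec adj? G w x →-dec adj? G x u →-dec
      ¬? (u ≟ w) →-dec ¬? (v ≟ x) →-dec unique? _≟_ _)

  fromMatrix : ∀ {k} → ∃ (MatrixColouring {k}) → BColouring G k
  fromMatrix (M , s , p , r) = record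
    { colour     = λ {u} {v} _ → M ! u , v
    ; undirected = λ e _ → s _ _ e
    ; proper     = p _ _ _
    ; rainbow    = r _ _ _ _
    }

  toMatrix : ∀ {k} → BColouring G (suc k) → ∃ (MatrixColouring {suc k})
  toMatrix {k} C = M , s , p , r
    where
    open BColouring C

    value : ∀ {u v} → Dec (Adj G u v) → Fin (suc k)
    value (yes e) = colour e
    value (no  _) = zero

    value-colour : ∀ {u v} (a? : Dec (Adj G u v)) (e : Adj G u v) →
                   value a? ≡ colour e
    value-colour (yes e′) e = trans (undirected e′ (symm G e)) (undirected _ e)
    value-colour (no ¬e)  e = ⊥-elim (¬e e)

    M : Matrix n (suc k)
    M = tabulate λ u → tabulate λ v → value (adj? G u v)

    M-colour : ∀ {u v} (e : Adj G u v) → M ! u , v ≡ colour e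
    M-colour {u} {v} e = begin
      M ! u , v                                          ≡⟨ cong (λ r → lookup r v) (lookup∘tabulate _ u) ⟩
      lookup (tabulate λ v → value (adj? G u v)) v       ≡⟨ lookup∘tabulate _ v ⟩
      value (adj? G u v)                                 ≡⟨ value-colour (adj? G u v) e ⟩
      colour e                                           ∎
      where open ≡-Reasoning

    s : ∀ u v → Adj G u v → M ! u , v ≡ M ! v , u
    s u v e = trans (M-colour e)
                (trans (undirected e (symm G e)) (sym (M-colour (symm G e))))

    p : ∀ u v w → Adj G u v → Adj G u w → v ≢ w → M ! u , v ≢ M ! u , w
    p u v w e f v≢w q =
      proper e f v≢w (trans (sym (M-colour e)) (trans q (M-colour f)))

    r : ∀ u v w x → Adj G u v → Adj G v w → Adj G w x → Adj G x u →
        u ≢ w → v ≢ x →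
        Unique (M ! u , v ∷ M ! v , w ∷ M ! w , x ∷ M ! x , u ∷ [])
    r u v w x e f g h u≢w v≢x
      rewrite M-colour e | M-colour f | M-colour g | M-colour h
      = rainbow e f g h u≢w v≢x

  bColouring? : U.Decidable (BColouring G)
  bColouring? zero =
    map′ (λ none → record
           { colour     = λ e → ⊥-elim (none _ _ e)
           ; undirected = λ e → ⊥-elim (none _ _ e)
           ; proper     = λ e → ⊥-elim (none _ _ e)
           ; rainbow    = λ e → ⊥-elim (none _ _ e)
           })
         (λ C u v e → case0 (BColouring.colour C e))
         (all? λ u → all? λ v → ¬? (adj? G u v))
    where
    case0 : Fin 0 → ⊥
    case0 ()
  bColouring? (suc k) =
    map′ fromMatrix toMatrix
         (search-Vec (search-Vec any? n) n matrixColouring?)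

  -- Distinct edges receive distinct colours.
  bColouring : BColouring G (n * n)
  bColouring = record
    { colour     = λ {u} {v} _ → c u v
    ; undirected = λ {u} {v} _ _ → c-sym u v
    ; proper     = λ {u} {v} {w} e f v≢w q →
        [ v≢w ∘ proj₂ , (λ { (refl , refl) → v≢w refl }) ]′ (c-inj u v u w q)
    ; rainbow    = λ {u} {v} {w} {x} e f g h u≢w v≢x →
        ( (λ q → [ (λ { (refl , _) → loop e }) , u≢w ∘ proj₁ ]′ (c-inj u v v w q))
        ∷ (λ q → [ u≢w ∘ proj₁ , (λ { (refl , _) → loop h }) ]′ (c-inj u v w x q))
        ∷ (λ q → [ (λ { (refl , _) → loop h }) , v≢x ∘ proj₂ ]′ (c-inj u v x u q))
        ∷ [])
        ∷ ( (λ q → [ (λ { (refl , _) → loop f }) , v≢x ∘ proj₁ ]′ (c-inj v w w x q))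
          ∷ (λ q → [ v≢x ∘ proj₁ , (λ { (refl , _) → loop e }) ]′ (c-inj v w x u q))
          ∷ [])
        ∷ ( (λ q → [ (λ { (refl , _) → loop g }) , u≢w ∘ sym ∘ proj₁ ]′ (c-inj w x x u q))
          ∷ [])
        ∷ [] ∷ []
    }
    where
    loop : ∀ {v} → Adj G v v → ⊥
    loop = irrefl G refl

    c : Fin n → Fin n → Fin (n * n)
    c u v with ≤-total u v
    ... | inj₁ _ = combine u v
    ... | inj₂ _ = combine v u

    c-sym : ∀ u v → c u v ≡ c v u
    c-sym u v with ≤-total u v | ≤-total v u
    ... | inj₁ u≤v | inj₁ v≤u rewrite ≤-antisym u≤v v≤u = refl
    ... | inj₁ _   | inj₂ _   = refl
    ... | inj₂ _   | inj₁ _   = refl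
    ... | inj₂ v≤u | inj₂ u≤v rewrite ≤-antisym u≤v v≤u = refl

    c-inj : ∀ u v x y → c u v ≡ c x y → (u ≡ x × v ≡ y) ⊎ (u ≡ y × v ≡ x)
    c-inj u v x y q with ≤-total u v | ≤-total x y
    ... | inj₁ _ | inj₁ _ = inj₁ (combine-injective u v x y q)
    ... | inj₁ _ | inj₂ _ = inj₂ (combine-injective u v y x q)
    ... | inj₂ _ | inj₁ _ = inj₂ (swap (combine-injective v u x y q))
    ... | inj₂ _ | inj₂ _ = inj₁ (swap (combine-injective v u y x q))

least : ∀ {P : ℕ → Set} → U.Decidable P → ∀ n → P n → ∃ (IsMinimum P)
least P? zero p = 0 , p , λ _ _ → z≤n
least {P} P? (suc n) p with P? 0
... | yes p₀ = 0 , p₀ , λ _ _ → z≤n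
... | no ¬p₀ with least (P? ∘ suc) n p
...   | m , pm , m≤ = suc m , pm , suc-m≤
  where
  suc-m≤ : ∀ k → P k → suc m ≤ k
  suc-m≤ zero    p₀ = ⊥-elim (¬p₀ p₀)
  suc-m≤ (suc k) pk = s≤s (m≤ k pk)

-- Abstract, since the type determines the number: the search by which it is
-- found should not be unfolded.
abstract
  minimum-colours : ∀ {n} (G : Graph n) → ∃ (IsMinimum (BColouring G))
  minimum-colours {n} G = least (bColouring? G) (n * n) (bColouring G)

q-B : ∀ {n} → Graph n → ℕ
q-B G = proj₁ (minimum-colours G)

{-# OPTIONS --safe #-}
module Submission where

-- Two edges conflict if they share a vertex or are opposite in a 4-cycle; a B-colouring gives
-- conflicting edges distinct colours.  All d Δ edges of a K d Δ are pairwise in conflict, so it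
-- needs d Δ colours.  Conversely, add the vertices in an order in which each has at most d earlier
-- neighbours, and colour greedily.  When v is added with earlier neighbours B, an edge v u can
-- conflict only with earlier edges w x, where w ∈ B and x is a common neighbour of w and u.
-- Without v u itself, these are at most d Δ - 1.  If there are d Δ - 1 for every u in B, then B
-- consists of d vertices of degree Δ with the same neighbourhood.  Otherwise some v u₀ has at most
-- d Δ - 2 conflicts; colouring it last among the edges from v to B saves one conflict for each of
-- the other edges as well, and d Δ - 1 colours suffice.

open import Defs
open import Data.Empty using (⊥-elim)
open import Data.Fin using (Fin; inject≤; zero; suc; toℕ; fromℕ<; _↑ˡ_; _↑ʳ_; splitAt; remQuot; combine)
open import Data.Fin.Properties as Fin
  using (_≟_; any?; all?; suc-injective; injective⇒≤; toℕ-injective; toℕ<n; fromℕ<-injective)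
open import Data.Fin.Subset
  using (Subset; inside; outside; ⊤; _∈_; _∉_; _⊆_; _∩_; _-_; Nonempty; ∣_∣)
open import Data.Fin.Subset.Properties
  using ( _∈?_; nonempty?; ∈⊤; anySubset?; ⊆-antisym; p⊂q⇒∣p∣<∣q∣; p∩q⊆p; p∩q⊆q
        ; x∈p∩q⁺; ∣p∩q∣≤∣p∣; p─q⊆p; x∈p∧x≢y⇒x∈p-y; x∈p⇒∣p-x∣<∣p∣)
open import Data.List as List using (List; []; _∷_; _++_; length; map; concatMap; filter; allFin)
open import Data.List.Extrema.Nat using (xs≤max; max≤v⁺)
open import Data.List.Membership.Propositional using () renaming (_∈_ to _∈ₗ_)
open import Data.List.Membership.Propositional.Properties
  using ( ∈-map⁺; ∈-map⁻; ∈-++⁻; ∈-++⁺ˡ; ∈-++⁺ʳ; ∈-filter⁺; ∈-tabulate⁺; ∈-tabulate⁻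
        ; ∈-concatMap⁺; ∈-allFin)
open import Data.List.Membership.Setoid.Properties using (index-injective)
open import Data.List.Properties using (length-map; length-++; length-tabulate; filter-notAll)
open import Data.List.Relation.Unary.All as All using ([]; _∷_)
open import Data.List.Relation.Unary.AllPairs using ([]; _∷_)
open import Data.List.Relation.Unary.Any as Any using (here; there)
open import Data.Nat using (ℕ; zero; suc; _+_; _*_; _≤_; _<_; z≤n; s≤s; s≤s⁻¹; _≤?_; _<?_)
open import Data.Nat.Properties as ℕ using (≤-refl; ≤-trans; ≤-reflexive; ≤-antisym; module ≤-Reasoning)
open import Data.Product using (∃; ∃₂; _×_; _,_; proj₁; proj₂; uncurry)
open import Data.Product.Properties using (≡-dec)
open import Data.Sum using (_⊎_; inj₁; inj₂; [_,_]′)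
open import Data.Vec using ([]; _∷_; here; there; tabulate)
open import Data.Vec.Properties using (lookup∘tabulate; []=⇒lookup; lookup⇒[]=)
open import Data.Vec.Properties.WithK using ([]=-irrelevant)
open import Function using (_∘_; case_of_)
open import Function.Bundles using (_⇔_; mk⇔; mk↔ₛ′; Injection; Inverse; Equivalence)
open import Function.Properties.Inverse using (↔⇒↣)
open import Function.Definitions using (Injective)
open import Relation.Binary using (DecidableEquality)
open import Relation.Binary.PropositionalEquality
open import Relation.Nullary using (¬_; Dec; yes; no; does)
open import Relation.Nullary.Decidable using (_×-dec_; _→-dec_; ¬?; decidable-stable; dec-true; map′)
open import Data.List.Membership.DecPropositional ℕ._≟_ using () renaming (_∈?_ to _∈ℕ?_)
import Data.Bool.Properties as Bool
import Data.Vec.Properties as Vec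
import Relation.Unary as U

open Graph
open Subgraph

private
  variable
    m n : ℕ

-- Finite subsets

module _ {P : Fin n → Set} (P? : U.Decidable P) where

  -- `N G u` is by definition `comprehension (adj? G u)`, so the two membership rules below also
  -- serve neighbourhoods.
  comprehension : Subset n
  comprehension = tabulate λ x → does (P? x)

  ∈-comprehension⁺ : ∀ {x} → P x → x ∈ comprehension
  ∈-comprehension⁺ {x} px =
    lookup⇒[]= x _ (trans (lookup∘tabulate _ x) (dec-true (P? x) px))

  ∈-comprehension⁻ : ∀ {x} → x ∈ comprehension → P x
  ∈-comprehension⁻ {x} x∈ with P? x | trans (sym (lookup∘tabulate (does ∘ P?) x)) ([]=⇒lookup x∈)
  ... | yes px | _ = px

∃∈-≡ : ∀ {p : Subset n} {s t : ∃ (_∈ p)} → proj₁ s ≡ proj₁ t → s ≡ t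
∃∈-≡ refl = cong (_ ,_) ([]=-irrelevant _ _)

x∉p-x : ∀ (p : Subset n) {x} → x ∉ p - x
x∉p-x (_ ∷ p) {zero}  ()
x∉p-x (_ ∷ p) {suc x} (there x∈) = x∉p-x p x∈

p⊆q∧∣q∣≤∣p∣⇒p≡q : ∀ {p q : Subset n} → p ⊆ q → ∣ q ∣ ≤ ∣ p ∣ → p ≡ q
p⊆q∧∣q∣≤∣p∣⇒p≡q {p = p} {q} p⊆q ∣q∣≤∣p∣ = ⊆-antisym p⊆q q⊆p
  where
  q⊆p : q ⊆ p
  q⊆p {x} x∈q = decidable-stable (x ∈? p) λ x∉p →
    ℕ.<⇒≱ (p⊂q⇒∣p∣<∣q∣ (p⊆q , x , x∈q , x∉p)) ∣q∣≤∣p∣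

element : (p : Subset n) → Fin ∣ p ∣ → Fin n
element (inside  ∷ p) zero    = zero
element (inside  ∷ p) (suc i) = suc (element p i)
element (outside ∷ p) i       = suc (element p i)

element-∈ : ∀ (p : Subset n) i → element p i ∈ p
element-∈ (inside  ∷ p) zero    = here
element-∈ (inside  ∷ p) (suc i) = there (element-∈ p i)
element-∈ (outside ∷ p) i       = there (element-∈ p i)

element-injective : ∀ (p : Subset n) → Injective _≡_ _≡_ (element p)
element-injective (inside  ∷ p) {zero}  {zero}  _  = refl
element-injective (inside  ∷ p) {suc i} {suc j} eq = cong suc (element-injective p (suc-injective eq))
element-injective (outside ∷ p) eq                 = element-injective p (suc-injective eq)

element-surjective : ∀ (p : Subset n) {x} → x ∈ p → ∃ λ i → element p i ≡ x
element-surjective (inside  ∷ p) here       = zero , refl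
element-surjective (inside  ∷ p) (there x∈) with element-surjective p x∈
... | i , eq = suc i , cong suc eq
element-surjective (outside ∷ p) (there x∈) with element-surjective p x∈
... | i , eq = i , cong suc eq

members : Subset n → List (Fin n)
members p = List.tabulate (element p)

∈-members⁺ : ∀ (p : Subset n) {x} → x ∈ p → x ∈ₗ members p
∈-members⁺ p x∈ with element-surjective p x∈
... | i , refl = ∈-tabulate⁺ i

∈-members⁻ : ∀ (p : Subset n) {x} → x ∈ₗ members p → x ∈ p
∈-members⁻ p x∈ with ∈-tabulate⁻ x∈
... | i , refl = element-∈ p i

length-members : ∀ (p : Subset n) → length (members p) ≡ ∣ p ∣
length-members p = length-tabulate (element p)

injective⇒≤∣p∣ : ∀ {f : Fin m → Fin n} {p} → Injective _≡_ _≡_ f → (∀ i → f i ∈ p) → m ≤ ∣ p ∣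
injective⇒≤∣p∣ {f = f} {p} f-inj f∈p = injective⇒≤ {f = index} λ {i} {j} eq →
  f-inj (trans (sym (element-index i)) (trans (cong (element p) eq) (element-index j)))
  where
  index = λ i → proj₁ (element-surjective p (f∈p i))
  element-index : ∀ i → element p (index i) ≡ f i
  element-index i = proj₂ (element-surjective p (f∈p i))

surjective⇒∣p∣≤ : ∀ {f : Fin m → Fin n} {p} → (∀ {x} → x ∈ p → ∃ λ i → f i ≡ x) → ∣ p ∣ ≤ m
surjective⇒∣p∣≤ {f = f} {p} onto = injective⇒≤ {f = index} λ {i} {j} eq →
  element-injective p (trans (sym (f-index i)) (trans (cong f eq) (f-index j)))
  where
  index = λ i → proj₁ (onto (element-∈ p i))
  f-index : ∀ i → f (index i) ≡ element p i
  f-index i = proj₂ (onto (element-∈ p i))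

image : (Fin m → Fin n) → Subset n
image f = comprehension λ x → any? λ i → f i ≟ x

∈-image⁺ : ∀ (f : Fin m → Fin n) i → f i ∈ image f
∈-image⁺ f i = ∈-comprehension⁺ (λ x → any? λ i → f i ≟ x) (i , refl)

∈-image⁻ : ∀ (f : Fin m → Fin n) {x} → x ∈ image f → ∃ λ i → f i ≡ x
∈-image⁻ f = ∈-comprehension⁻ λ x → any? λ i → f i ≟ x

-- Graphs

module _ (G : Graph n) where

  ∈-N⁺ : ∀ {u v} → Adj G u v → v ∈ N G u
  ∈-N⁺ {u} = ∈-comprehension⁺ (adj? G u)

  ∈-N⁻ : ∀ {u v} → v ∈ N G u → Adj G u v
  ∈-N⁻ {u} = ∈-comprehension⁻ (adj? G u)

  degree≤maxDegree : ∀ v → degree G v ≤ maxDegree G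
  degree≤maxDegree v = All.lookup (xs≤max 0 (map (degree G) (allFin n))) (∈-map⁺ (degree G) (∈-allFin v))

  maxDegree≤ : ∀ {Δ} → (∀ v → degree G v ≤ Δ) → maxDegree G ≤ Δ
  maxDegree≤ bound = max≤v⁺ {xs = map (degree G) (allFin n)} z≤n
    (All.tabulate λ d∈ → case ∈-map⁻ (degree G) d∈ of λ where
    (v , _ , refl) → bound v)

-- Complete bipartite subgraphs

-- A copy of `K d Δ` freed from the encoding by `splitAt`. The two sides are automatically disjoint,
-- because adjacent vertices differ.
record Biclique {n} (G : Graph n) (d Δ : ℕ) : Set where
  field
    left            : Fin d → Fin n
    right           : Fin Δ → Fin n
    left-injective  : Injective _≡_ _≡_ left
    right-injective : Injective _≡_ _≡_ right
    across          : ∀ i j → Adj G (left i) (right j)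

-- Only images of edges of `K` become edges of the subgraph, so adjacency is reflected even if `G`
-- has further edges among these vertices.
injection⇒contains : ∀ {G : Graph n} {K : Graph m} (f : Fin m → Fin n) → Injective _≡_ _≡_ f →
                     (∀ {i j} → Adj K i j → Adj G (f i) (f j)) → Contains G K
injection⇒contains {n} {m} {G} {K} f f-inj f-hom = H , record
  { bijection = mk↔ₛ′ (λ i → f i , ∈-image⁺ f i) (λ (_ , x∈) → proj₁ (∈-image⁻ f x∈))
      (λ (x , x∈) → ∃∈-≡ (proj₂ (∈-image⁻ f x∈)))
      (λ i → f-inj (proj₂ (∈-image⁻ f (∈-image⁺ f i))))
  ; adjacency = λ i j → mk⇔ (λ e → i , j , e , refl , refl)
      (λ (i′ , j′ , e , p , q) → subst₂ (Adj K) (f-inj p) (f-inj q) e)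
  }
  where
  H : Subgraph G
  H = record
    { vertices  = image f
    ; edges     = record
      { Adj    = λ u v → ∃₂ λ i j → Adj K i j × f i ≡ u × f j ≡ v
      ; adj?   = λ u v → any? λ i → any? λ j → adj? K i j ×-dec f i ≟ u ×-dec f j ≟ v
      ; symm   = λ (i , j , e , p , q) → j , i , symm K e , q , p
      ; irrefl = λ { refl (i , j , e , p , q) → irrefl K (f-inj (trans p (sym q))) e }
      }
    ; endpoints = λ { (i , j , _ , refl , refl) → ∈-image⁺ f i , ∈-image⁺ f j }
    ; included  = λ { (_ , _ , e , refl , refl) → f-hom e }
    }

module _ (d Δ : ℕ) where

  open CompleteBipartite d Δ

  K-across : ∀ i j → Adj (K d Δ) (i ↑ˡ Δ) (d ↑ʳ j)
  K-across i j rewrite Fin.splitAt-↑ˡ d i Δ | Fin.splitAt-↑ʳ d Δ j = _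

  K-biclique : Biclique (K d Δ) d Δ
  K-biclique = record
    { left            = _↑ˡ Δ
    ; right           = d ↑ʳ_
    ; left-injective  = Fin.↑ˡ-injective Δ _ _
    ; right-injective = Fin.↑ʳ-injective d _ _
    ; across          = K-across
    }

  data Side : Fin (d + Δ) → Set where
    isLeft  : ∀ i → Side (i ↑ˡ Δ)
    isRight : ∀ j → Side (d ↑ʳ j)

  side : ∀ x → Side x
  side x with splitAt d x in eq
  ... | inj₁ i = subst Side (Fin.splitAt⁻¹-↑ˡ {i = x} eq) (isLeft i)
  ... | inj₂ j = subst Side (Fin.splitAt⁻¹-↑ʳ {i = x} eq) (isRight j)

  K-left-neighbours : ∀ {i x} → Adj (K d Δ) (i ↑ˡ Δ) x → ∃ λ j → d ↑ʳ j ≡ x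
  K-left-neighbours {i} {x} e with side x
  ... | isRight j = j , refl
  ... | isLeft i′ rewrite Fin.splitAt-↑ˡ d i Δ | Fin.splitAt-↑ˡ d i′ Δ = ⊥-elim e

  K-right-neighbours : ∀ {j x} → Adj (K d Δ) (d ↑ʳ j) x → ∃ λ i → i ↑ˡ Δ ≡ x
  K-right-neighbours {j} {x} e with side x
  ... | isLeft i = i , refl
  ... | isRight j′ rewrite Fin.splitAt-↑ʳ d Δ j | Fin.splitAt-↑ʳ d Δ j′ = ⊥-elim e

  K-maxDegree≤ : d ≤ Δ → maxDegree (K d Δ) ≤ Δ
  K-maxDegree≤ d≤Δ = maxDegree≤ (K d Δ) λ v → bound (side v)
    where
    bound : ∀ {v} → Side v → degree (K d Δ) v ≤ Δ
    bound (isLeft i)  = surjective⇒∣p∣≤ (K-left-neighbours ∘ ∈-N⁻ (K d Δ))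
    bound (isRight j) = ≤-trans (surjective⇒∣p∣≤ (K-right-neighbours ∘ ∈-N⁻ (K d Δ))) d≤Δ

  -- A right vertex of the subgraph has only left neighbours, hence at most `d`. Every edge has a
  -- right end, so without right vertices the subgraph has no edges.
  K-degenerate : Degenerate d (K d Δ)
  K-degenerate H (x , x∈H) with any? (λ j → (d ↑ʳ j) ∈? vertices H)
  ... | yes (j , j∈H) =
    d ↑ʳ j , j∈H , surjective⇒∣p∣≤ (K-right-neighbours ∘ included H ∘ ∈-N⁻ (edges H))
  -- The neighbourhood of `x` is empty; `f` only has to be some map out of `Fin d`.
  ... | no  noRight   = x , x∈H , surjective⇒∣p∣≤ {f = _↑ˡ Δ} (⊥-elim ∘ isolated (side x) ∘ ∈-N⁻ (edges H))
    where
    isolated : ∀ {x y} → Side x → ¬ Adj (edges H) x y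
    isolated (isRight j) e = noRight (j , proj₁ (endpoints H e))
    isolated (isLeft i)  e with K-left-neighbours (included H e)
    ... | j , refl = noRight (j , proj₂ (endpoints H e))

  contains⇒biclique : ∀ {G : Graph n} → Contains G (K d Δ) → Biclique G d Δ
  contains⇒biclique {G = G} (H , iso) = record
    { left            = λ i → f (i ↑ˡ Δ)
    ; right           = λ j → f (d ↑ʳ j)
    ; left-injective  = Fin.↑ˡ-injective Δ _ _ ∘ f-inj
    ; right-injective = Fin.↑ʳ-injective d _ _ ∘ f-inj
    ; across          = λ i j → included H (Equivalence.to (adjacency _ _) (K-across i j))
    }
    where
    open _≅_ iso
    open Inverse bijection using (to)
    f = λ i → proj₁ (to i)
    f-inj : Injective _≡_ _≡_ f
    f-inj = Injection.injective (↔⇒↣ bijection) ∘ ∃∈-≡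

  biclique⇒contains : ∀ {G : Graph n} → Biclique G d Δ → Contains G (K d Δ)
  biclique⇒contains {n} {G} B = injection⇒contains f (λ {x} {y} → f-inj x y) (λ {x} {y} → f-hom x y)
    where
    open Biclique B
    f : Fin (d + Δ) → Fin n
    f x = [ left , right ]′ (splitAt d x)

    disjoint : ∀ i j → left i ≢ right j
    disjoint i j eq = irrefl G eq (across i j)

    f-inj : ∀ x y → f x ≡ f y → x ≡ y
    f-inj x y eq with side x | side y
    ... | isLeft i | isLeft i′ rewrite Fin.splitAt-↑ˡ d i Δ | Fin.splitAt-↑ˡ d i′ Δ =
      cong (_↑ˡ Δ) (left-injective eq)
    ... | isLeft i | isRight j rewrite Fin.splitAt-↑ˡ d i Δ | Fin.splitAt-↑ʳ d Δ j =
      ⊥-elim (disjoint i j eq)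
    ... | isRight j | isLeft i rewrite Fin.splitAt-↑ˡ d i Δ | Fin.splitAt-↑ʳ d Δ j =
      ⊥-elim (disjoint i j (sym eq))
    ... | isRight j | isRight j′ rewrite Fin.splitAt-↑ʳ d Δ j | Fin.splitAt-↑ʳ d Δ j′ =
      cong (d ↑ʳ_) (right-injective eq)

    f-hom : ∀ x y → Adj (K d Δ) x y → Adj G (f x) (f y)
    f-hom x y e with splitAt d x | splitAt d y
    ... | inj₁ i | inj₂ j = across i j
    ... | inj₂ j | inj₁ i = symm G (across i j)

  -- A left vertex is already adjacent to all `Δ` right vertices, so the degree bound leaves no room
  -- for other neighbours.
  biclique⇒sameNeighbourhood : ∀ {G : Graph n} → maxDegree G ≤ Δ →
                               Biclique G d Δ → SameNeighbourhood G d Δ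
  biclique⇒sameNeighbourhood {G = G} bounded B =
    image left , injective⇒≤∣p∣ left-injective (∈-image⁺ left) ,
    (λ u∈ → trans (cong ∣_∣ (N≡right u∈)) (≤-antisym ∣right∣≤ ≤∣right∣)) ,
    (λ u∈ v∈ → trans (N≡right u∈) (sym (N≡right v∈)))
    where
    open Biclique B

    ≤∣right∣ : Δ ≤ ∣ image right ∣
    ≤∣right∣ = injective⇒≤∣p∣ right-injective (∈-image⁺ right)

    ∣right∣≤ : ∣ image right ∣ ≤ Δ
    ∣right∣≤ = surjective⇒∣p∣≤ (∈-image⁻ right)

    right⊆N : ∀ i → image right ⊆ N G (left i)
    right⊆N i x∈ with ∈-image⁻ right x∈
    ... | j , refl = ∈-N⁺ G (across i j)

    N≡right : ∀ {u} → u ∈ image left → N G u ≡ image right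
    N≡right u∈ with ∈-image⁻ left u∈
    ... | i , refl = sym (p⊆q∧∣q∣≤∣p∣⇒p≡q (right⊆N i)
      (≤-trans (degree≤maxDegree G _) (≤-trans bounded ≤∣right∣)))

  -- Since `1 ≤ d`, there is a first left vertex; its neighbourhood, shared by all of `S`, supplies
  -- the right side.
  sameNeighbourhood⇒biclique : ∀ {G : Graph n} → 1 ≤ d → SameNeighbourhood G d Δ → Biclique G d Δ
  sameNeighbourhood⇒biclique {G = G} (s≤s z≤n) (S , d≤∣S∣ , deg≡Δ , N≡) = record
    { left            = left
    ; right           = right
    ; left-injective  = Fin.inject≤-injective d≤∣S∣ d≤∣S∣ _ _ ∘ element-injective S
    ; right-injective = Fin.inject≤-injective Δ≤deg Δ≤deg _ _ ∘ element-injective (N G (left zero))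
    ; across          = λ i j → ∈-N⁻ G (subst (right j ∈_) (N≡ (left∈S zero) (left∈S i)) (element-∈ _ _))
    }
    where
    left : Fin d → _
    left i = element S (inject≤ i d≤∣S∣)

    left∈S : ∀ i → left i ∈ S
    left∈S i = element-∈ S _

    Δ≤deg : Δ ≤ degree G (left zero)
    Δ≤deg = ≤-reflexive (sym (deg≡Δ (left∈S zero)))

    right : Fin Δ → _
    right j = element (N G (left zero)) (inject≤ j Δ≤deg)

  -- Two disjoint edges of a biclique are opposite in a 4-cycle.
  biclique⇒≤colours : ∀ {G : Graph n} {k} → Biclique G d Δ → BColouring G k → d * Δ ≤ k
  biclique⇒≤colours {G = G} B C = injective⇒≤ {f = f} λ {x} {y} eq →
    trans (sym (Fin.combine-remQuot {d} Δ x))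
      (trans (cong (λ (i , j) → combine i j) (distinct _ _ _ _ eq)) (Fin.combine-remQuot {d} Δ y))
    where
    open Biclique B
    open BColouring C

    f = λ x → let (i , j) = remQuot {d} Δ x in colour (across i j)

    distinct : ∀ i j i′ j′ → colour (across i j) ≡ colour (across i′ j′) → (i , j) ≡ (i′ , j′)
    distinct i j i′ j′ eq with i ≟ i′ | j ≟ j′
    ... | yes refl | yes refl = refl
    ... | yes refl | no j≢j′  = ⊥-elim (proper _ _ (j≢j′ ∘ right-injective) eq)
    ... | no i≢i′  | yes refl = ⊥-elim (proper (symm G (across i j)) (symm G (across i′ j))
      (i≢i′ ∘ left-injective)
      (trans (sym (undirected _ _)) (trans eq (undirected _ _))))
    ... | no i≢i′  | no j≢j′  with
      rainbow (across i j) (symm G (across i′ j)) (across i′ j′) (symm G (across i j′))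
        (i≢i′ ∘ left-injective) (j≢j′ ∘ right-injective)
    ... | (_ ∷ e≢g ∷ _) ∷ _ = ⊥-elim (e≢g eq)

module _ (G : Graph n) (d Δ : ℕ) where

  -- Allows the passage from the number of colours to the common neighbourhoods to be argued by
  -- contradiction.
  sameNeighbourhood? : Dec (SameNeighbourhood G d Δ)
  sameNeighbourhood? =
    map′ (λ (S , d≤ , deg≡ , N≡) → S , d≤ , (λ {v} → deg≡ v) , (λ {u} {v} → N≡ u v))
         (λ (S , d≤ , deg≡ , N≡) → S , d≤ , (λ v → deg≡ {v}) , (λ u v → N≡ {u} {v}))
         (anySubset? λ S →
           (d ≤? ∣ S ∣) ×-dec
           (all? λ v → v ∈? S →-dec degree G v ℕ.≟ Δ) ×-dec
           (all? λ u → all? λ v → u ∈? S →-dec v ∈? S →-dec Vec.≡-dec Bool._≟_ (N G u) (N G v)))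

-- Greedy colouring

-- Pigeonhole: if every colour below `C` occurred in `cs`, choosing a position for each would inject
-- `Fin C` into the positions of `cs`.
fresh : ∀ {C} (cs : List ℕ) → length cs < C → ∃ λ c → c < C × ¬ c ∈ₗ cs
fresh {C} cs ∣cs∣<C with any? {n = C} (λ i → ¬? (toℕ i ∈ℕ? cs))
... | yes (i , i∉) = toℕ i , toℕ<n i , i∉
... | no  none     = ⊥-elim (ℕ.<⇒≱ ∣cs∣<C (injective⇒≤ {f = λ i → Any.index (used i)}
        λ {i} {j} eq → toℕ-injective (index-injective (setoid ℕ) (used i) (used j) eq)))
  where
  used : ∀ i → toℕ i ∈ₗ cs
  used i = decidable-stable (toℕ i ∈ℕ? cs) λ i∉ → none (i , i∉)

module _ {A : Set} (_#_ : A → A → Set) (C : ℕ) where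

  -- The last item of the list is coloured first.
  data GreedySequence : List A → Set where
    []     : GreedySequence []
    extend : ∀ {a as} (forbidden : List A) → length forbidden < C →
             (∀ {b} → b ∈ₗ as → a # b → b ∈ₗ forbidden) →
             GreedySequence as → GreedySequence (a ∷ as)

  greedy : (∀ {a} → ¬ a # a) → (∀ {a b} → a # b → b # a) → DecidableEquality A →
           ∀ {as} → GreedySequence as →
           ∃ λ (f : A → ℕ) → (∀ {a} → a ∈ₗ as → f a < C) ×
                             (∀ {a b} → a ∈ₗ as → b ∈ₗ as → a # b → f a ≢ f b)
  greedy irr #-sym _≟ᴬ_ []       = (λ _ → 0) , (λ ()) , (λ ())
  greedy irr #-sym _≟ᴬ_ (extend {a} {as} forbidden short covers s)
    with f , f<C , f≢ ← greedy irr #-sym _≟ᴬ_ s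
    with c , c<C , c∉ ← fresh (map f forbidden) (subst (_< C) (sym (length-map f forbidden)) short)
    = g , g<C , g≢
    where
    g : A → ℕ
    g x with x ≟ᴬ a
    ... | yes _ = c
    ... | no  _ = f x

    old : ∀ {x} → x ∈ₗ a ∷ as → x ≢ a → x ∈ₗ as
    old (here x≡a) x≢a = ⊥-elim (x≢a x≡a)
    old (there x∈) _   = x∈

    c≢ : ∀ {x} → x ∈ₗ as → a # x → c ≢ f x
    c≢ x∈ a#x eq = c∉ (subst (_∈ₗ _) (sym eq) (∈-map⁺ f (covers x∈ a#x)))

    g<C : ∀ {x} → x ∈ₗ a ∷ as → g x < C
    g<C {x} x∈ with x ≟ᴬ a
    ... | yes _  = c<C
    ... | no x≢a = f<C (old x∈ x≢a)

    g≢ : ∀ {x y} → x ∈ₗ a ∷ as → y ∈ₗ a ∷ as → x # y → g x ≢ g y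
    g≢ {x} {y} x∈ y∈ x#y with x ≟ᴬ a | y ≟ᴬ a
    ... | yes refl | yes refl = λ _ → irr x#y
    ... | yes refl | no y≢a   = c≢ (old y∈ y≢a) x#y
    ... | no x≢a   | yes refl = c≢ (old x∈ x≢a) (#-sym x#y) ∘ sym
    ... | no x≢a   | no y≢a   = f≢ (old x∈ x≢a) (old y∈ y≢a) x#y

-- Conflicting edges

Edge : ℕ → Set
Edge n = Fin n × Fin n

-- Sorting the ends gives both orientations of an edge the same representative.
edge : Fin n → Fin n → Edge n
edge u v with Fin.≤-total u v
... | inj₁ _ = u , v
... | inj₂ _ = v , u

edge-comm : ∀ (u v : Fin n) → edge u v ≡ edge v u
edge-comm u v with Fin.≤-total u v | Fin.≤-total v u
... | inj₁ u≤v | inj₁ v≤u rewrite Fin.≤-antisym u≤v v≤u = refl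
... | inj₁ _   | inj₂ _   = refl
... | inj₂ _   | inj₁ _   = refl
... | inj₂ v≤u | inj₂ u≤v rewrite Fin.≤-antisym u≤v v≤u = refl

edge-injective : ∀ (u v x y : Fin n) → edge u v ≡ edge x y → (u ≡ x × v ≡ y) ⊎ (u ≡ y × v ≡ x)
edge-injective u v x y eq with Fin.≤-total u v | Fin.≤-total x y
edge-injective u v x y refl | inj₁ _ | inj₁ _ = inj₁ (refl , refl)
edge-injective u v x y refl | inj₁ _ | inj₂ _ = inj₂ (refl , refl)
edge-injective u v x y refl | inj₂ _ | inj₁ _ = inj₂ (refl , refl)
edge-injective u v x y refl | inj₂ _ | inj₂ _ = inj₁ (refl , refl)

length-concatMap-≤ : ∀ {A B : Set} (f : A → List B) {b} → (∀ x → length (f x) ≤ b) →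
                     ∀ xs → length (concatMap f xs) ≤ length xs * b
length-concatMap-≤ f bound []       = z≤n
length-concatMap-≤ f bound (x ∷ xs) rewrite length-++ (f x) {concatMap f xs} =
  ℕ.+-mono-≤ (bound x) (length-concatMap-≤ f bound xs)

length-concatMap-< : ∀ {A B : Set} (f : A → List B) {b} → (∀ x → length (f x) ≤ b) →
                     ∀ {x xs} → x ∈ₗ xs → length (f x) < b →
                     length (concatMap f xs) < length xs * b
length-concatMap-< f bound {xs = x ∷ xs} (here refl) short rewrite length-++ (f x) {concatMap f xs} =
  ℕ.+-mono-<-≤ short (length-concatMap-≤ f bound xs)
length-concatMap-< f bound {xs = x ∷ xs} (there x∈)  short rewrite length-++ (f x) {concatMap f xs} =
  ℕ.+-mono-≤-< (bound x) (length-concatMap-< f bound x∈ short)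

module Conflicts (G : Graph n) where

  data _#_ : Edge n → Edge n → Set where
    incident : ∀ {u v w} → v ≢ w → edge u v # edge u w
    opposite : ∀ {u v w x} → Adj G u v → Adj G v w → Adj G w x → Adj G x u → u ≢ w → v ≢ x →
               edge u v # edge w x

  #-sym : ∀ {e f} → e # f → f # e
  #-sym (incident v≢w)             = incident (v≢w ∘ sym)
  #-sym (opposite e f g h u≢w v≢x) = opposite g h e f (u≢w ∘ sym) (v≢x ∘ sym)

  #-irrefl : ∀ {e f} → e # f → e ≢ f
  #-irrefl (incident {u} {v} {w} v≢w) eq with edge-injective u v u w eq
  ... | inj₁ (_ , v≡w)    = v≢w v≡w
  ... | inj₂ (u≡w , v≡u)  = v≢w (trans v≡u u≡w)
  #-irrefl (opposite {u} {v} {w} {x} _ _ _ h u≢w _) eq with edge-injective u v w x eq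
  ... | inj₁ (u≡w , _) = u≢w u≡w
  ... | inj₂ (u≡x , _) = irrefl G (sym u≡x) h

  consecutive : ∀ {u v w} → u ≢ w → edge u v # edge v w
  consecutive {u} {v} u≢w = subst (_# _) (edge-comm v u) (incident u≢w)

  common : Fin n → Fin n → Subset n
  common u w = N G w ∩ N G u

  candidatesAt : Fin n → Fin n → List (Edge n)
  candidatesAt u w = map (w ,_) (members (common u w))

  -- Let B be the set of neighbours of v that precede it in the elimination order.  Every earlier
  -- edge in conflict with v u has an end w in B and its other end x adjacent to u, so it is among
  -- the candidates (w , x).  The edge v u itself is the candidate (u , v), and v w is (w , v).
  candidates : Subset n → Fin n → List (Edge n)
  candidates B u = concatMap (candidatesAt u) (members B)

  ∈-candidates⁺ : ∀ {B u w x} → w ∈ B → Adj G w x → Adj G u x → (w , x) ∈ₗ candidates B u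
  ∈-candidates⁺ {B} {u} {w} w∈B wx ux = ∈-concatMap⁺ (candidatesAt u) (Any.map
    (λ { refl → ∈-map⁺ (w ,_) (∈-members⁺ (common u w) (x∈p∩q⁺ (∈-N⁺ G wx , ∈-N⁺ G ux))) })
    (∈-members⁺ B w∈B))

  length-candidatesAt : ∀ u w → length (candidatesAt u w) ≡ ∣ common u w ∣
  length-candidatesAt u w =
    trans (length-map (w ,_) (members (common u w))) (length-members (common u w))

  -- Counting candidates

  module _ {Δ : ℕ} (bounded : maxDegree G ≤ Δ) where

    degree≤ : ∀ u → degree G u ≤ Δ
    degree≤ u = ≤-trans (degree≤maxDegree G u) bounded

    candidatesAt-≤ : ∀ u w → length (candidatesAt u w) ≤ Δ
    candidatesAt-≤ u w = ≤-trans (≤-reflexive (length-candidatesAt u w))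
      (≤-trans (∣p∩q∣≤∣p∣ (N G w) (N G u)) (degree≤ w))

    candidates-≤ : ∀ B u → length (candidates B u) ≤ ∣ B ∣ * Δ
    candidates-≤ B u = subst (λ b → length (candidates B u) ≤ b * Δ) (length-members B)
      (length-concatMap-≤ (candidatesAt u) (candidatesAt-≤ u) (members B))

    candidates-< : ∀ B u {w} → w ∈ B → ∣ common u w ∣ < Δ → length (candidates B u) < ∣ B ∣ * Δ
    candidates-< B u {w} w∈B short = subst (λ b → length (candidates B u) < b * Δ) (length-members B)
      (length-concatMap-< (candidatesAt u) (candidatesAt-≤ u) (∈-members⁺ B w∈B)
        (subst (_< Δ) (sym (length-candidatesAt u w)) short))

    -- The bound d Δ is attained for every u in B only if B has d vertices and all the
    -- common neighbourhoods have the full size Δ.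
    few-candidates : ∀ {d} → 1 ≤ Δ → ¬ SameNeighbourhood G d Δ →
                     ∀ B → ∣ B ∣ ≤ d → Nonempty B → ∃ λ u → u ∈ B × length (candidates B u) < d * Δ
    few-candidates {d} (s≤s z≤n) ¬same B ∣B∣≤d (z , z∈B)
      with any? (λ u → u ∈? B ×-dec length (candidates B u) <? d * Δ)
    ... | yes found = found
    ... | no  none  = ⊥-elim (¬same (B , d≤∣B∣ ,
      -- For a single `u`, the intersection of `N G u` with itself has size at least `Δ`. For two
      -- members of `B`, the intersection fills both neighbourhoods, which are therefore equal.
      (λ {u} u∈ → ≤-antisym (degree≤ u) (≤-trans (Δ≤common u∈ u∈) (∣p∩q∣≤∣p∣ (N G u) (N G u)))) ,
      (λ {u} {v} u∈ v∈ →
        trans (sym (full (degree≤ u) (Δ≤common v∈ u∈) (p∩q⊆p (N G u) (N G v))))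
              (full (degree≤ v) (Δ≤common v∈ u∈) (p∩q⊆q (N G u) (N G v))))))
      where
      many : ∀ {u} → u ∈ B → d * Δ ≤ length (candidates B u)
      many u∈B = ℕ.≮⇒≥ λ few → none (_ , u∈B , few)

      d≤∣B∣ : d ≤ ∣ B ∣
      d≤∣B∣ = ℕ.*-cancelʳ-≤ d ∣ B ∣ Δ (≤-trans (many z∈B) (candidates-≤ B z))

      Δ≤common : ∀ {u w} → u ∈ B → w ∈ B → Δ ≤ ∣ common u w ∣
      Δ≤common {u} u∈B w∈B = ℕ.≮⇒≥ λ short →
        ℕ.<⇒≱ (ℕ.<-≤-trans (candidates-< B u w∈B short) (ℕ.*-monoˡ-≤ Δ ∣B∣≤d)) (many u∈B)

      full : ∀ {p q : Subset n} → ∣ p ∣ ≤ Δ → Δ ≤ ∣ q ∣ → q ⊆ p → q ≡ p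
      full ∣p∣≤Δ Δ≤∣q∣ q⊆p = p⊆q∧∣q∣≤∣p∣⇒p≡q q⊆p (≤-trans ∣p∣≤Δ Δ≤∣q∣)

  -- The state of the induction on the vertex set: the edges of `G` inside `S`, listed so that
  -- greedy colouring with `C` colours succeeds.
  record Ordering (C : ℕ) (S : Subset n) : Set where
    field
      ordered  : List (Edge n)
      sequence : GreedySequence _#_ C ordered
      sound    : ∀ {e} → e ∈ₗ ordered → ∃₂ λ u v → u ∈ S × v ∈ S × Adj G u v × e ≡ edge u v
      complete : ∀ {u v} → u ∈ S → v ∈ S → Adj G u v → edge u v ∈ₗ ordered

  -- Adding a vertex to an ordering

  module AddVertex {C} (S : Subset n) (v : Fin n) (O : Ordering C (S - v))
                   (B : Subset n)
                   (∈B⁻ : ∀ {u} → u ∈ B → Adj G v u × u ∈ S)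
                   (∈B⁺ : ∀ {u} → Adj G v u → u ∈ S → u ∈ B) where

    open Ordering O

    -- An intermediate list: `us` grows from the empty list until it exhausts `B`.
    with-edges : List (Fin n) → List (Edge n)
    with-edges us = map (edge v) us ++ ordered

    locate : ∀ {us a b} → (∀ {u} → u ∈ₗ us → u ∈ B) → edge a b ∈ₗ with-edges us →
             (a ≡ v × b ∈ₗ us) ⊎ (b ≡ v × a ∈ₗ us) ⊎ (a ∈ S - v × b ∈ S - v × Adj G a b)
    locate {us} {a} {b} us⊆B ab∈ with ∈-++⁻ (map (edge v) us) ab∈
    ... | inj₁ new with ∈-map⁻ (edge v) new
    ...   | u , u∈ , eq with edge-injective a b v u eq
    ...     | inj₁ (refl , refl) = inj₁ (refl , u∈)
    ...     | inj₂ (refl , refl) = inj₂ (inj₁ (refl , u∈))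
    locate {us} {a} {b} us⊆B ab∈ | inj₂ old with sound old
    ...   | x , y , x∈ , y∈ , xy , eq with edge-injective a b x y eq
    ...     | inj₁ (refl , refl) = inj₂ (inj₂ (x∈ , y∈ , xy))
    ...     | inj₂ (refl , refl) = inj₂ (inj₂ (y∈ , x∈ , symm G xy))

    -- The condition for `x ≡ v` records that a candidate `(w , v)` matters only once `v w` has been
    -- listed; this is what allows the candidate of a postponed edge to be discarded.
    Covered : List (Fin n) → Fin n → Edge n → Set
    Covered us u f = ∃₂ λ w x → (w , x) ∈ₗ candidates B u × (w , x) ≢ (u , v) × (x ≡ v → w ∈ₗ us) ×
                                f ≡ edge w x

    -- An edge `v c` gives `(c , v)`, since `v` is a common neighbour of `c` and `u`; an edge `u c`
    -- gives `(u , c)`. In a 4-cycle through `v u`, the opposite edge has one end adjacent to `v`,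
    -- hence in `B`, and the other adjacent to `u`. The equation for `e` is a separate argument
    -- because matching on `e # f` cannot unify with `edge v u`.
    covered : ∀ {us u e f} → (∀ {u} → u ∈ₗ us → u ∈ B) → u ∈ B → e ≡ edge v u →
              f ∈ₗ with-edges us → e # f → Covered us u f
    covered {us} {u} us⊆B u∈B eq f∈ (incident {a} {b} {c} b≢c) with edge-injective a b v u eq
    ... | inj₁ (refl , refl) with locate us⊆B f∈
    ...   | inj₁ (_ , c∈) =
      c , v , ∈-candidates⁺ (us⊆B c∈) (symm G (proj₁ (∈B⁻ (us⊆B c∈)))) (symm G (proj₁ (∈B⁻ u∈B))) ,
      (λ { refl → b≢c refl }) , (λ _ → c∈) , edge-comm v c
    ...   | inj₂ (inj₁ (_ , v∈)) = ⊥-elim (irrefl G refl (proj₁ (∈B⁻ (us⊆B v∈))))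
    ...   | inj₂ (inj₂ (v∈ , _)) = ⊥-elim (x∉p-x S v∈)
    covered {us} {u} us⊆B u∈B eq f∈ (incident {a} {b} {c} b≢c) | inj₂ (refl , refl) with locate us⊆B f∈
    ...   | inj₁ (refl , _)           = ⊥-elim (irrefl G refl (proj₁ (∈B⁻ u∈B)))
    ...   | inj₂ (inj₁ (c≡v , _))     = ⊥-elim (b≢c (sym c≡v))
    ...   | inj₂ (inj₂ (_ , _ , uc)) =
      u , c , ∈-candidates⁺ u∈B uc uc , (λ { refl → b≢c refl }) , (λ c≡v → ⊥-elim (b≢c (sym c≡v))) , refl
    covered {us} {u} us⊆B u∈B eq f∈ (opposite {a} {b} {w} {x} ab bw wx xa a≢w b≢x)
      with edge-injective a b v u eq
    ... | inj₁ (refl , refl) with locate us⊆B f∈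
    ...   | inj₁ (w≡v , _)        = ⊥-elim (a≢w (sym w≡v))
    ...   | inj₂ (inj₁ (x≡v , _)) = ⊥-elim (irrefl G x≡v xa)
    ...   | inj₂ (inj₂ (_ , x∈ , _)) =
      x , w , ∈-candidates⁺ (∈B⁺ (symm G xa) (p─q⊆p S _ x∈)) (symm G wx) bw ,
      (λ { refl → b≢x refl }) , (λ w≡v → ⊥-elim (a≢w (sym w≡v))) , edge-comm w x
    covered {us} {u} us⊆B u∈B eq f∈ (opposite {a} {b} {w} {x} ab bw wx xa a≢w b≢x)
        | inj₂ (refl , refl) with locate us⊆B f∈
    ...   | inj₁ (w≡v , _)        = ⊥-elim (irrefl G (sym w≡v) bw)
    ...   | inj₂ (inj₁ (x≡v , _)) = ⊥-elim (b≢x (sym x≡v))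
    ...   | inj₂ (inj₂ (w∈ , _ , _)) =
      w , x , ∈-candidates⁺ (∈B⁺ bw (p─q⊆p S _ w∈)) wx (symm G xa) ,
      (λ { refl → a≢w refl }) , (λ x≡v → ⊥-elim (b≢x (sym x≡v))) , refl

    ordering : ∀ {us} → (∀ {u} → u ∈ₗ us → u ∈ B) → (∀ {u} → u ∈ B → u ∈ₗ us) → v ∈ S →
               GreedySequence _#_ C (with-edges us) → Ordering C S
    ordering {us} us⊆B B⊆us v∈S s = record
      { ordered  = with-edges us
      ; sequence = s
      ; sound    = sound′
      ; complete = complete′
      }
      where
      sound′ : ∀ {e} → e ∈ₗ with-edges us → ∃₂ λ x y → x ∈ S × y ∈ S × Adj G x y × e ≡ edge x y
      sound′ e∈ with ∈-++⁻ (map (edge v) us) e∈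
      ... | inj₁ new with ∈-map⁻ (edge v) new
      ...   | u , u∈ , eq = v , u , v∈S , proj₂ (∈B⁻ (us⊆B u∈)) , proj₁ (∈B⁻ (us⊆B u∈)) , eq
      sound′ e∈ | inj₂ old with sound old
      ...   | x , y , x∈ , y∈ , xy , eq = x , y , p─q⊆p S _ x∈ , p─q⊆p S _ y∈ , xy , eq

      complete′ : ∀ {x y} → x ∈ S → y ∈ S → Adj G x y → edge x y ∈ₗ with-edges us
      complete′ {x} {y} x∈ y∈ xy with x ≟ v | y ≟ v
      ... | yes refl | _        = ∈-++⁺ˡ (∈-map⁺ (edge v) (B⊆us (∈B⁺ xy y∈)))
      ... | no _     | yes refl = subst (_∈ₗ with-edges us) (edge-comm v x)
        (∈-++⁺ˡ (∈-map⁺ (edge v) (B⊆us (∈B⁺ (symm G xy) x∈))))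
      ... | no x≢v   | no y≢v   =
        ∈-++⁺ʳ (map (edge v) us) (complete (x∈p∧x≢y⇒x∈p-y x∈ x≢v) (x∈p∧x≢y⇒x∈p-y y∈ y≢v) xy)

    remove : Edge n → List (Edge n) → List (Edge n)
    remove e = filter λ f → ¬? (≡-dec _≟_ _≟_ f e)

    length-remove : ∀ {e es} → e ∈ₗ es → length (remove e es) < length es
    length-remove {e} {es} e∈ = filter-notAll _ es (Any.map (λ eq ¬≡ → ¬≡ (sym eq)) e∈)

    -- Provides the candidates to be discarded: `w` is `u` for the edge being coloured, and `u₀` for
    -- the postponed edge.
    own-candidate : ∀ {u w} → w ∈ B → u ∈ B → (w , v) ∈ₗ candidates B u
    own-candidate w∈ u∈ = ∈-candidates⁺ w∈ (symm G (proj₁ (∈B⁻ w∈))) (symm G (proj₁ (∈B⁻ u∈)))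

    -- v u₀ is coloured last among the edges at v: the others then need not avoid its colour.
    add-edges : ∀ {u₀ us} → u₀ ∈ B → (∀ {u} → u ∈ B → length (candidates B u) ≤ suc C) →
                (∀ {u} → u ∈ₗ us → u ∈ B - u₀) → GreedySequence _#_ C (with-edges us)
    add-edges {u₀} {[]}     _    _     _  = sequence
    add-edges {u₀} {u ∷ us} u₀∈B bound us⊆ = extend
      (map (uncurry edge) (remove (u₀ , v) (remove (u , v) (candidates B u))))
      -- Of at most `suc C` candidates two distinct ones, `(u , v)` and `(u₀ , v)`, are discarded,
      -- so fewer than `C` remain.
      (s≤s⁻¹ (begin-strict
        suc (length (map (uncurry edge) (remove (u₀ , v) (remove (u , v) (candidates B u)))))
          ≡⟨ cong suc (length-map _ (remove (u₀ , v) (remove (u , v) (candidates B u)))) ⟩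
        suc (length (remove (u₀ , v) (remove (u , v) (candidates B u))))
          ≤⟨ length-remove (∈-filter⁺ _ (own-candidate u₀∈B u∈B) (u₀≢u ∘ cong proj₁)) ⟩
        length (remove (u , v) (candidates B u))  <⟨ length-remove (own-candidate u∈B u∈B) ⟩
        length (candidates B u)                   ≤⟨ bound u∈B ⟩
        suc C                                     ∎))
      (λ f∈ e#f → case covered us⊆B u∈B refl f∈ e#f of λ where
        (w , x , wx∈ , wx≢ , w∈us , refl) → ∈-map⁺ _ (∈-filter⁺ _ (∈-filter⁺ _ wx∈ wx≢)
          -- If the candidate were `(u₀ , v)`, then `u₀` would be in `us`, which lies in `B - u₀`.
          λ { refl → x∉p-x B (us⊆ (there (w∈us refl))) }))
      (add-edges u₀∈B bound (us⊆ ∘ there))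
      where
      open ≤-Reasoning
      us⊆B : ∀ {u} → u ∈ₗ us → u ∈ B
      us⊆B = p─q⊆p B _ ∘ us⊆ ∘ there
      u∈B : u ∈ B
      u∈B = p─q⊆p B _ (us⊆ (here refl))
      u₀≢u : u₀ ≢ u
      u₀≢u refl = x∉p-x B (us⊆ (here refl))

    -- The edge to the good vertex `u₀` goes to the head of the list. All other edges at `v` then
    -- count against it and only its own candidate is discarded, which is why `u₀` needs the sharper
    -- bound `C`.
    add-all : v ∈ S → (∀ {u} → u ∈ B → length (candidates B u) ≤ suc C) →
              (Nonempty B → ∃ λ u → u ∈ B × length (candidates B u) ≤ C) → Ordering C S
    add-all v∈S bound good with nonempty? B
    ... | no  B-empty = ordering {[]} (λ ()) (λ u∈ → ⊥-elim (B-empty (_ , u∈))) v∈S sequence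
    ... | yes B-nonempty with good B-nonempty
    ...   | u₀ , u₀∈B , short = ordering {u₀ ∷ members (B - u₀)} us⊆B B⊆us v∈S (extend
      (map (uncurry edge) (remove (u₀ , v) (candidates B u₀)))
      (begin-strict
        length (map (uncurry edge) (remove (u₀ , v) (candidates B u₀)))
          ≡⟨ length-map _ (remove (u₀ , v) (candidates B u₀)) ⟩
        length (remove (u₀ , v) (candidates B u₀))  <⟨ length-remove (own-candidate u₀∈B u₀∈B) ⟩
        length (candidates B u₀)                    ≤⟨ short ⟩
        C                                           ∎)
      (λ f∈ e#f → case covered (us⊆B ∘ there) u₀∈B refl f∈ e#f of λ where
        (w , x , wx∈ , wx≢ , _ , refl) → ∈-map⁺ _ (∈-filter⁺ _ wx∈ wx≢))
      (add-edges u₀∈B bound (∈-members⁻ (B - u₀))))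
      where
      open ≤-Reasoning
      us⊆B : ∀ {u} → u ∈ₗ u₀ ∷ members (B - u₀) → u ∈ B
      us⊆B (here refl) = u₀∈B
      us⊆B (there u∈)  = p─q⊆p B _ (∈-members⁻ (B - u₀) u∈)
      B⊆us : ∀ {u} → u ∈ B → u ∈ₗ u₀ ∷ members (B - u₀)
      B⊆us {u} u∈ with u ≟ u₀
      ... | yes u≡u₀ = here u≡u₀
      ... | no  u≢u₀ = there (∈-members⁺ (B - u₀) (x∈p∧x≢y⇒x∈p-y u∈ u≢u₀))

  -- From degeneracy to colourings

  induced : Subset n → Subgraph G
  induced S = record
    { vertices  = S
    ; edges     = record
      { Adj    = λ u v → Adj G u v × u ∈ S × v ∈ S
      ; adj?   = λ u v → adj? G u v ×-dec u ∈? S ×-dec v ∈? S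
      ; symm   = λ (uv , u∈ , v∈) → symm G uv , v∈ , u∈
      ; irrefl = λ u≡v (uv , _) → irrefl G u≡v uv
      }
    ; endpoints = proj₂
    ; included  = proj₁
    }

  colouring : ∀ {C} → Ordering C ⊤ → BColouring G C
  colouring {C} O with greedy _#_ C (λ e#e → #-irrefl e#e refl) #-sym (≡-dec _≟_ _≟_) (Ordering.sequence O)
  ... | f , f<C , f≢ = record
    { colour     = colour
    ; undirected = λ {u} {v} e e′ → Fin.fromℕ<-cong _ _ (cong f (edge-comm u v)) (colour< e) (colour< e′)
    ; proper     = λ e f v≢w → differ e f (incident v≢w)
    ; rainbow    = λ e f g h u≢w v≢x →
        -- Of the six pairs of edges of the 4-cycle, four are consecutive and two are opposite.
        (differ e f (consecutive u≢w) ∷ differ e g (opposite e f g h u≢w v≢x) ∷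
         differ e h (#-sym (consecutive (v≢x ∘ sym))) ∷ []) ∷
        (differ f g (consecutive v≢x) ∷ differ f h (opposite f g h e v≢x (u≢w ∘ sym)) ∷ []) ∷
        (differ g h (consecutive (u≢w ∘ sym)) ∷ []) ∷ [] ∷ []
    }
    where
    colour< : ∀ {u v} → Adj G u v → f (edge u v) < C
    colour< e = f<C (Ordering.complete O ∈⊤ ∈⊤ e)

    colour : ∀ {u v} → Adj G u v → Fin C
    colour e = fromℕ< (colour< e)

    differ : ∀ {u v w x} (e : Adj G u v) (e′ : Adj G w x) → edge u v # edge w x → colour e ≢ colour e′
    differ e e′ e#e′ eq = f≢ (Ordering.complete O ∈⊤ ∈⊤ e) (Ordering.complete O ∈⊤ ∈⊤ e′) e#e′
      (fromℕ<-injective _ _ (colour< e) (colour< e′) eq)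

  module _ {d C : ℕ} (degenerate : Degenerate d G)
           (bound : ∀ B → ∣ B ∣ ≤ d → ∀ u → length (candidates B u) ≤ suc C)
           (good  : ∀ B → ∣ B ∣ ≤ d → Nonempty B → ∃ λ u → u ∈ B × length (candidates B u) ≤ C) where

    -- Degeneracy of the induced subgraph yields a vertex `v` with at most `d` neighbours in `S`;
    -- its edges are coloured after those inside `S - v`. The recursion is on the bound `k`, as
    -- `S - v` is not structurally smaller.
    orderable : ∀ k S → ∣ S ∣ ≤ k → Ordering C S
    orderable k S ∣S∣≤k with nonempty? S
    ... | no  S-empty = record
      { ordered  = []
      ; sequence = []
      ; sound    = λ ()
      ; complete = λ u∈ → ⊥-elim (S-empty (_ , u∈))
      }
    ... | yes S-nonempty with degenerate (induced S) S-nonempty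
    orderable zero    S ∣S∣≤k | yes _ | v , v∈S , _     = ⊥-elim (ℕ.n≮0 (≤-trans (x∈p⇒∣p-x∣<∣p∣ v∈S) ∣S∣≤k))
    orderable (suc k) S ∣S∣≤k | yes _ | v , v∈S , ∣B∣≤d = add-all v∈S (λ _ → bound B ∣B∣≤d _) (good B ∣B∣≤d)
      where
      B = N (edges (induced S)) v

      ∈B⁻ : ∀ {u} → u ∈ B → Adj G v u × u ∈ S
      ∈B⁻ u∈ = let (vu , _ , u∈S) = ∈-N⁻ (edges (induced S)) u∈ in vu , u∈S

      ∈B⁺ : ∀ {u} → Adj G v u → u ∈ S → u ∈ B
      ∈B⁺ vu u∈S = ∈-N⁺ (edges (induced S)) (vu , v∈S , u∈S)

      rest : Ordering C (S - v)
      rest = orderable k (S - v) (s≤s⁻¹ (≤-trans (x∈p⇒∣p-x∣<∣p∣ v∈S) ∣S∣≤k))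

      open AddVertex S v rest B ∈B⁻ ∈B⁺

    -- Applied with `C` equal to `d * Δ`, where `bound` and `good` are plain counting, and to its
    -- predecessor, where `good` comes from `few-candidates`.
    colourable : BColouring G C
    colourable = colouring (orderable _ ⊤ ≤-refl)

-- Bounds on `q-B` and the characterization of equality

module _ {d Δ : ℕ} (G : Graph n) (degenerate : Degenerate d G) (bounded : maxDegree G ≤ Δ) where

  open Conflicts G

  candidates≤dΔ : ∀ B → ∣ B ∣ ≤ d → ∀ u → length (candidates B u) ≤ d * Δ
  candidates≤dΔ B ∣B∣≤d u = ≤-trans (candidates-≤ bounded B u) (ℕ.*-monoˡ-≤ Δ ∣B∣≤d)

  q-B≤dΔ : q-B G ≤ d * Δ
  q-B≤dΔ = proj₂ (proj₂ (minimum-colours G)) _ (colourable degenerate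
    (λ B ∣B∣≤d u → ℕ.m≤n⇒m≤1+n (candidates≤dΔ B ∣B∣≤d u))
    (λ B ∣B∣≤d (u , u∈B) → u , u∈B , candidates≤dΔ B ∣B∣≤d u))

  q-B<dΔ : 1 ≤ d → 1 ≤ Δ → ¬ SameNeighbourhood G d Δ → q-B G < d * Δ
  -- As `d * Δ` is positive, it can be written `suc C`; abstracting both counting lemmas along with
  -- it restates them in terms of `C`.
  q-B<dΔ 1≤d 1≤Δ ¬same with d * Δ | ℕ.*-mono-≤ 1≤d 1≤Δ | candidates≤dΔ | few-candidates bounded 1≤Δ ¬same
  ... | suc C | _ | bound | few = s≤s (proj₂ (proj₂ (minimum-colours G)) _ (colourable degenerate bound
    (λ B ∣B∣≤d B-nonempty → let (u , u∈B , short) = few B ∣B∣≤d B-nonempty in u , u∈B , s≤s⁻¹ short)))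

biclique⇒q-B≥ : ∀ {d Δ} (G : Graph n) → Biclique G d Δ → d * Δ ≤ q-B G
biclique⇒q-B≥ {d = d} {Δ} G B = biclique⇒≤colours d Δ B (proj₁ (proj₂ (minimum-colours G)))

corollary2p3 : (d Δ : ℕ) → 1 ≤ d → d ≤ Δ →
    IsMaximum (λ q → ∃₂ λ n (G : Graph n) →
    Degenerate d G × maxDegree G ≤ Δ × q-B G ≡ q)
    (d * Δ) ×
    ((n : ℕ) (G : Graph n) → Degenerate d G → maxDegree G ≤ Δ →
    (q-B G ≡ d * Δ ⇔ Contains G (K d Δ)) ×
    (Contains G (K d Δ) ⇔ SameNeighbourhood G d Δ))
corollary2p3 d Δ 1≤d d≤Δ =
  -- The maximum is attained by `K d Δ` itself.
  ( ( d + Δ , K d Δ , K-degenerate d Δ , K-maxDegree≤ d Δ d≤Δ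
    , ≤-antisym (q-B≤dΔ (K d Δ) (K-degenerate d Δ) (K-maxDegree≤ d Δ d≤Δ))
                (biclique⇒q-B≥ (K d Δ) (K-biclique d Δ)))
  , λ { _ (_ , G , degenerate , bounded , refl) → q-B≤dΔ G degenerate bounded })
  , λ n G degenerate bounded →
      let same⇒contains : SameNeighbourhood G d Δ → Contains G (K d Δ)
          same⇒contains = biclique⇒contains d Δ ∘ sameNeighbourhood⇒biclique d Δ 1≤d
      in
      -- Without `d` such vertices, one colour could be saved.
      mk⇔ (λ q≡dΔ → same⇒contains (decidable-stable (sameNeighbourhood? G d Δ)
              λ ¬same → ℕ.<⇒≢ (q-B<dΔ G degenerate bounded 1≤d (≤-trans 1≤d d≤Δ) ¬same) q≡dΔ))
          (λ c → ≤-antisym (q-B≤dΔ G degenerate bounded) (biclique⇒q-B≥ G (contains⇒biclique d Δ c))) ,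
      mk⇔ (biclique⇒sameNeighbourhood d Δ bounded ∘ contains⇒biclique d Δ) same⇒contains
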